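{- There exists a $\lambda$-term $M$ for which both leftmost-outermost and rightmost-innermost outperform $\mathsf{P}_\varepsilon$ for every $0<\varepsilon<1$; that is, for every $0<\varepsilon<1$, $$\mathsf{Steps}_{\mathsf{LO}}(M)<\mathsf{ExpLen}_M(\varepsilon)\quad\text{and}\quad \mathsf{Steps}_{\mathsf{RI}}(M)<\mathsf{ExpLen}_M(\varepsilon).$$
   Context: $\lambda$-terms: $\Lambda$ is the set of untyped $\lambda$-terms $M,N ::= x \mid MN \mid \lambda x.M$ ($x$ in a countably infinite set of variables), modulo $\alpha$-equivalence. A $\beta$-redex is a term $(\lambda x.M)N$; its contractum is $M\{N/x\}$ (capture-avoiding substitution). $M\to_\beta N$ means that $N$ is obtained from $M$ by replacing one occurrence of a redex in $M$ (anywhere in the term) by its contractum. A term is in normal form if it has no $\beta$-reduct, reducible otherwise. The leftmost-outermost ($\mathsf{LO}$) redex of a reducible term is the leftmost among its redexes, and the rightmost-innermost ($\mathsf{RI}$) redex is the rightmost among its redexes, the position of a redex being measured by its beginning symbol in the written term. $\mathsf{LO}(M)$, $\mathsf{RI}(M)$ denote the terms obtained from $M$ by firing these redexes. For $\mathsf{S}\in\{\mathsf{LO},\mathsf{RI}\}$, $\mathsf{Steps}_{\mathsf{S}}(M)$ is the length of the sequence $M,\mathsf{S}(M),\mathsf{S}(\mathsf{S}(M)),\dots$ (number of steps) if it reaches a normal form, and $+\infty$ otherwise. For $\varepsilon\in[0,1]$, the randomised strategy $\mathsf{P}_\varepsilon$ assigns to each reducible term $M$ the distribution $\mathsf{P}_\varepsilon(M)=\varepsilon\,\delta_{\mathsf{LO}(M)}+(1-\varepsilon)\,\delta_{\mathsf{RI}(M)}$;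 it is undefined on normal forms. Put $\mathbb{P}(M\to N)=\mathsf{P}_\varepsilon(M)(N)$ if $M$ is reducible, $0$ if $M$ is a normal form. The computation starting from $M$ is the sequence $(\rho_i)_{i\in\mathbb{N}}$ with $\rho_0$ the Dirac distribution at $M$ and $\rho_{i+1}(N)=\sum_{L}\rho_i(L)\,\mathbb{P}(L\to N)$. Write $|\rho|=\sum_N\rho(N)$ and $\mathsf{ExpLen}_M(\varepsilon)=\mathsf{Steps}_{\mathsf{P}_\varepsilon}(M)=\sum_{i=1}^\infty|\rho_i|\in\mathbb{R}\cup\{+\infty\}$. -}

module Defs where

open import Data.Bool using (if_then_else_)
open import Data.Integer using (+_)
open import Data.List using (List; []; _∷_; _++_; map; foldr; concatMap; deduplicate; fromMaybe)
import Data.List.Extrema as Extrema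
open import Data.List.Membership.Propositional using (_∈_; _∉_; lose)
open import Data.List.Membership.Propositional.Properties
  using (∈-map⁺; ∈-++⁺ˡ; ∈-++⁺ʳ; ∈-concatMap⁺; ∈-deduplicate⁺)
open import Data.List.Relation.Unary.Any using (here; there)
open import Data.Maybe using (Maybe; nothing; just; maybe; zipWith; _>>=_)
open import Data.Nat as ℕ using (ℕ; zero; suc; _⊔_)
import Data.Nat.Properties as ℕ
open import Data.Product using (_×_; _,_; ∃; Σ-syntax)
open import Data.Rational as ℚ using (ℚ; 0ℚ; 1ℚ; ½; ∣_∣)
import Data.Rational.Properties as ℚ
import Data.Rational.Solver as ℚSolver
open import Relation.Binary.PropositionalEquality
  using (_≡_; _≢_; refl; sym; trans; cong; cong₂; subst)
open import Relation.Nullary using (¬_; Dec; no; does)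
open import Relation.Nullary.Decidable using (map′; _×-dec_; dec-false)

-- Real numbers, as Cauchy sequences of rationals.  Two sequences with
-- the same limit represent the same real; the arithmetic, _<_ and _SumsTo_
-- below respect this.

IsCauchy : (ℕ → ℚ) → Set
IsCauchy a = ∀ δ → 0ℚ ℚ.< δ →
  ∃ λ N → ∀ m n → N ℕ.≤ m → N ℕ.≤ n → ∣ a m ℚ.- a n ∣ ℚ.< δ

record ℝ : Set where
  constructor mkℝ
  field
    seq    : ℕ → ℚ
    cauchy : IsCauchy seq

open ℝ public

private

  half-pos : ∀ {δ} → 0ℚ ℚ.< δ → 0ℚ ℚ.< ½ ℚ.* δ
  half-pos {δ} 0<δ = subst (ℚ._< ½ ℚ.* δ) (ℚ.*-zeroʳ ½) (ℚ.*-monoʳ-<-pos ½ {0ℚ} {δ} 0<δ)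

  half+half : ∀ δ → ½ ℚ.* δ ℚ.+ ½ ℚ.* δ ≡ δ
  half+half δ = trans (sym (ℚ.*-distribʳ-+ δ ½ ½)) (ℚ.*-identityˡ δ)

  abs-*-< : ∀ {p q P Q} → ∣ p ∣ ℚ.< P → ∣ q ∣ ℚ.< Q → ∣ p ℚ.* q ∣ ℚ.< P ℚ.* Q
  abs-*-< {p} {q} {P} {Q} p<P q<Q = begin-strict
    ∣ p ℚ.* q ∣      ≡⟨ ℚ.∣p*q∣≡∣p∣*∣q∣ p q ⟩
    ∣ p ∣ ℚ.* ∣ q ∣  ≤⟨ ℚ.*-monoʳ-≤-nonNeg ∣ q ∣ {{ℚ.∣-∣-nonNeg q}} (ℚ.<⇒≤ p<P) ⟩
    P ℚ.* ∣ q ∣      <⟨ ℚ.*-monoʳ-<-pos P {{ℚ.positive (ℚ.≤-<-trans (ℚ.0≤∣p∣ p) p<P)}} q<Q ⟩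
    P ℚ.* Q          ∎
    where open ℚ.≤-Reasoning

  const-cauchy : ∀ q → IsCauchy (λ _ → q)
  const-cauchy q δ 0<δ =
    0 , λ _ _ _ _ → subst (λ z → ∣ z ∣ ℚ.< δ) (sym (ℚ.+-inverseʳ q)) 0<δ

  abstract
    neg-cauchy : ∀ a → IsCauchy a → IsCauchy (λ n → ℚ.- a n)
    neg-cauchy a ca δ 0<δ with ca δ 0<δ
    ... | N , h = N , λ m n N≤m N≤n →
      subst (ℚ._< δ) (trans (sym (ℚ.∣-p∣≡∣p∣ (a m ℚ.- a n)))
                            (cong ∣_∣ (ℚ.neg-distrib-+ (a m) (ℚ.- a n))))
            (h m n N≤m N≤n)

    +-cauchy : ∀ a b → IsCauchy a → IsCauchy b → IsCauchy (λ n → a n ℚ.+ b n)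
    +-cauchy a b ca cb δ 0<δ with ca (½ ℚ.* δ) (half-pos 0<δ) | cb (½ ℚ.* δ) (half-pos 0<δ)
    ... | N₁ , h₁ | N₂ , h₂ = N₁ ⊔ N₂ , λ m n N≤m N≤n → begin-strict
      ∣ (a m ℚ.+ b m) ℚ.- (a n ℚ.+ b n) ∣      ≡⟨ cong ∣_∣ (regroup (a m) (b m) (a n) (b n)) ⟩
      ∣ (a m ℚ.- a n) ℚ.+ (b m ℚ.- b n) ∣      ≤⟨ ℚ.∣p+q∣≤∣p∣+∣q∣ (a m ℚ.- a n) (b m ℚ.- b n) ⟩
      ∣ a m ℚ.- a n ∣ ℚ.+ ∣ b m ℚ.- b n ∣      <⟨ ℚ.+-mono-<
        (h₁ m n (ℕ.m⊔n≤o⇒m≤o N₁ N₂ N≤m) (ℕ.m⊔n≤o⇒m≤o N₁ N₂ N≤n))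
        (h₂ m n (ℕ.m⊔n≤o⇒n≤o N₁ N₂ N≤m) (ℕ.m⊔n≤o⇒n≤o N₁ N₂ N≤n)) ⟩
      ½ ℚ.* δ ℚ.+ ½ ℚ.* δ                      ≡⟨ half+half δ ⟩
      δ                                        ∎
      where
      open ℚ.≤-Reasoning
      regroup : ∀ p q r s → (p ℚ.+ q) ℚ.- (r ℚ.+ s) ≡ (p ℚ.- r) ℚ.+ (q ℚ.- s)
      regroup = solve 4 (λ p q r s → (p :+ q) :- (r :+ s) := (p :- r) :+ (q :- s)) refl
        where open ℚSolver.+-*-Solver

  eventually-bounded : ∀ a → IsCauchy a →
    ∃ λ B → 0ℚ ℚ.< B × ∃ λ N → ∀ n → N ℕ.≤ n → ∣ a n ∣ ℚ.< B
  eventually-bounded a ca with ca 1ℚ (ℚ.positive⁻¹ 1ℚ)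
  ... | N , h = B , 0<B , N , bound
    where
    open ℚ.≤-Reasoning
    B = 1ℚ ℚ.+ ∣ a N ∣
    0<B : 0ℚ ℚ.< B
    0<B = ℚ.+-mono-<-≤ (ℚ.positive⁻¹ 1ℚ) (ℚ.0≤∣p∣ (a N))
    split : ∀ p q → p ≡ (p ℚ.- q) ℚ.+ q
    split = solve 2 (λ p q → p := (p :- q) :+ q) refl
      where open ℚSolver.+-*-Solver
    bound : ∀ n → N ℕ.≤ n → ∣ a n ∣ ℚ.< B
    bound n N≤n = begin-strict
      ∣ a n ∣                      ≡⟨ cong ∣_∣ (split (a n) (a N)) ⟩
      ∣ (a n ℚ.- a N) ℚ.+ a N ∣    ≤⟨ ℚ.∣p+q∣≤∣p∣+∣q∣ (a n ℚ.- a N) (a N) ⟩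
      ∣ a n ℚ.- a N ∣ ℚ.+ ∣ a N ∣  <⟨ ℚ.+-monoˡ-< ∣ a N ∣ (h n N N≤n ℕ.≤-refl) ⟩
      B                            ∎

  divide : ∀ B δ → 0ℚ ℚ.< B → 0ℚ ℚ.< δ → Σ[ η ∈ ℚ ] (0ℚ ℚ.< η × B ℚ.* η ≡ δ)
  divide B δ 0<B 0<δ = 1/B ℚ.* δ
    , subst (ℚ._< 1/B ℚ.* δ) (ℚ.*-zeroʳ 1/B)
        (ℚ.*-monoʳ-<-pos 1/B {{ℚ.1/pos⇒pos B}} {0ℚ} {δ} 0<δ)
    , trans (sym (ℚ.*-assoc B 1/B δ))
            (trans (cong (ℚ._* δ) (ℚ.*-inverseʳ B)) (ℚ.*-identityˡ δ))
    where
    instance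
      B-pos : ℚ.Positive B
      B-pos = ℚ.positive 0<B
      B-nonZero : ℚ.NonZero B
      B-nonZero = ℚ.pos⇒nonZero B
    1/B = ℚ.1/ B

  *-estimate : ∀ p q r s {A B α β δ} →
    ∣ p ∣ ℚ.< A → ∣ q ℚ.- s ∣ ℚ.< α → A ℚ.* α ≡ ½ ℚ.* δ →
    ∣ s ∣ ℚ.< B → ∣ p ℚ.- r ∣ ℚ.< β → B ℚ.* β ≡ ½ ℚ.* δ →
    ∣ p ℚ.* q ℚ.- r ℚ.* s ∣ ℚ.< δ
  *-estimate p q r s {A} {B} {α} {β} {δ} p<A qs<α Aα≡ s<B pr<β Bβ≡ = begin-strict
    ∣ p ℚ.* q ℚ.- r ℚ.* s ∣
      ≡⟨ cong ∣_∣ (regroup p q r s) ⟩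
    ∣ p ℚ.* (q ℚ.- s) ℚ.+ s ℚ.* (p ℚ.- r) ∣
      ≤⟨ ℚ.∣p+q∣≤∣p∣+∣q∣ (p ℚ.* (q ℚ.- s)) (s ℚ.* (p ℚ.- r)) ⟩
    ∣ p ℚ.* (q ℚ.- s) ∣ ℚ.+ ∣ s ℚ.* (p ℚ.- r) ∣
      <⟨ ℚ.+-mono-< (abs-*-< {p} {q ℚ.- s} {A} {α} p<A qs<α)
                    (abs-*-< {s} {p ℚ.- r} {B} {β} s<B pr<β) ⟩
    A ℚ.* α ℚ.+ B ℚ.* β
      ≡⟨ cong₂ ℚ._+_ Aα≡ Bβ≡ ⟩
    ½ ℚ.* δ ℚ.+ ½ ℚ.* δ
      ≡⟨ half+half δ ⟩
    δ ∎
    where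
    open ℚ.≤-Reasoning
    regroup : ∀ p q r s → p ℚ.* q ℚ.- r ℚ.* s ≡ p ℚ.* (q ℚ.- s) ℚ.+ s ℚ.* (p ℚ.- r)
    regroup = solve 4 (λ p q r s → p :* q :- r :* s := p :* (q :- s) :+ s :* (p :- r)) refl
      where open ℚSolver.+-*-Solver

  abstract
    *-cauchy : ∀ a b → IsCauchy a → IsCauchy b → IsCauchy (λ n → a n ℚ.* b n)
    *-cauchy a b ca cb δ 0<δ =
      let A , 0<A , N₁ , hA = eventually-bounded a ca
          B , 0<B , N₂ , hB = eventually-bounded b cb
          α , 0<α , Aα≡ = divide A (½ ℚ.* δ) 0<A (half-pos 0<δ)
          β , 0<β , Bβ≡ = divide B (½ ℚ.* δ) 0<B (half-pos 0<δ)
          N₃ , hα = cb α 0<α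
          N₄ , hβ = ca β 0<β
      in N₁ ⊔ N₂ ⊔ (N₃ ⊔ N₄) , λ m n N≤m N≤n →
      let m₁₂ = ℕ.m⊔n≤o⇒m≤o (N₁ ⊔ N₂) (N₃ ⊔ N₄) N≤m
          m₃₄ = ℕ.m⊔n≤o⇒n≤o (N₁ ⊔ N₂) (N₃ ⊔ N₄) N≤m
          n₁₂ = ℕ.m⊔n≤o⇒m≤o (N₁ ⊔ N₂) (N₃ ⊔ N₄) N≤n
          n₃₄ = ℕ.m⊔n≤o⇒n≤o (N₁ ⊔ N₂) (N₃ ⊔ N₄) N≤n
      in *-estimate (a m) (b m) (a n) (b n)
           (hA m (ℕ.m⊔n≤o⇒m≤o N₁ N₂ m₁₂))
           (hα m n (ℕ.m⊔n≤o⇒m≤o N₃ N₄ m₃₄) (ℕ.m⊔n≤o⇒m≤o N₃ N₄ n₃₄)) Aα≡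
           (hB n (ℕ.m⊔n≤o⇒n≤o N₁ N₂ n₁₂))
           (hβ m n (ℕ.m⊔n≤o⇒n≤o N₃ N₄ m₃₄) (ℕ.m⊔n≤o⇒n≤o N₃ N₄ n₃₄)) Bβ≡

infixl 6 _+_ _-_
infixl 7 _*_
infix  8 -_
infix  4 _<_

fromℚ : ℚ → ℝ
fromℚ q = mkℝ (λ _ → q) (const-cauchy q)

fromℕ : ℕ → ℝ
fromℕ k = fromℚ (+ k ℚ./ 1)

0ℝ 1ℝ : ℝ
0ℝ = fromℚ 0ℚ
1ℝ = fromℚ 1ℚ

_+_ _*_ : ℝ → ℝ → ℝ
x + y = mkℝ (λ n → seq x n ℚ.+ seq y n) (+-cauchy (seq x) (seq y) (cauchy x) (cauchy y))
x * y = mkℝ (λ n → seq x n ℚ.* seq y n) (*-cauchy (seq x) (seq y) (cauchy x) (cauchy y))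

-_ : ℝ → ℝ
- x = mkℝ (λ n → ℚ.- seq x n) (neg-cauchy (seq x) (cauchy x))

_-_ : ℝ → ℝ → ℝ
x - y = x + (- y)

_<_ : ℝ → ℝ → Set
x < y = Σ[ δ ∈ ℚ ] (0ℚ ℚ.< δ × ∃ λ N → ∀ n → N ℕ.≤ n → seq x n ℚ.+ δ ℚ.≤ seq y n)

Σᴸ : {A : Set} → List A → (A → ℝ) → ℝ
Σᴸ xs f = foldr (λ a s → f a + s) 0ℝ xs

data ℝ∞ : Set where
  fin : ℝ → ℝ∞
  +∞  : ℝ∞

infix 4 _<∞_

data _<∞_ : ℝ∞ → ℝ∞ → Set where
  fin<fin : ∀ {x y} → x < y → fin x <∞ fin y
  fin<+∞  : ∀ {x} → fin x <∞ +∞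

partialSum : (ℕ → ℝ) → ℕ → ℝ
partialSum f zero    = 0ℝ
partialSum f (suc n) = partialSum f n + f (suc n)

-- f SumsTo s  means  ∑_{i=1}^∞ f i = s; the term f 0 is not included.
infix 4 _SumsTo_

_SumsTo_ : (ℕ → ℝ) → ℝ∞ → Set
f SumsTo fin x = ∀ δ → 0ℝ < δ → ∃ λ N → ∀ n → N ℕ.≤ n →
                   (- δ < partialSum f n - x) × (partialSum f n - x < δ)
f SumsTo +∞    = ∀ B → ∃ λ N → ∀ n → N ℕ.≤ n → B < partialSum f n

-- Whether a series or a reduction sequence has a finite value is not
-- decidable, so quantities in ℝ ∪ {+∞} are given by their graphs: A a says
-- that a is the value of A.  A ≺ B says that A and B both have a value and
-- that the former is strictly smaller.
infix 4 _≺_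

_≺_ : (ℝ∞ → Set) → (ℝ∞ → Set) → Set
A ≺ B = ∃ λ a → ∃ λ b → A a × B b × a <∞ b

-- λ-terms modulo α, in de Bruijn notation.  Indices that exceed the number
-- of enclosing abstractions are free variables.

infixl 7 _·_

data Λ : Set where
  var : ℕ → Λ
  _·_ : Λ → Λ → Λ
  ƛ   : Λ → Λ

private
  var-injective : ∀ {x y} → var x ≡ var y → x ≡ y
  var-injective refl = refl

  ·-injective : ∀ {M M′ N N′} → M · N ≡ M′ · N′ → M ≡ M′ × N ≡ N′
  ·-injective refl = refl , refl

  ƛ-injective : ∀ {M M′} → ƛ M ≡ ƛ M′ → M ≡ M′
  ƛ-injective refl = refl

infix 4 _≟_

_≟_ : (M N : Λ) → Dec (M ≡ N)
var x   ≟ var y     = map′ (cong var) var-injective (x ℕ.≟ y)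
var _   ≟ (_ · _)   = no λ ()
var _   ≟ ƛ _       = no λ ()
(_ · _) ≟ var _     = no λ ()
(M · N) ≟ (M′ · N′) = map′ (λ (p , q) → cong₂ _·_ p q) ·-injective (M ≟ M′ ×-dec N ≟ N′)
(_ · _) ≟ ƛ _       = no λ ()
ƛ _     ≟ var _     = no λ ()
ƛ _     ≟ (_ · _)   = no λ ()
ƛ M     ≟ ƛ M′      = map′ (cong ƛ) ƛ-injective (M ≟ M′)

rename : (ℕ → ℕ) → Λ → Λ
rename r (var x) = var (r x)
rename r (M · N) = rename r M · rename r N
rename r (ƛ M)   = ƛ (rename r↑ M)
  where
  r↑ : ℕ → ℕ
  r↑ zero    = zero
  r↑ (suc x) = suc (r x)

lift : (ℕ → Λ) → ℕ → Λ
lift σ zero    = var zero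
lift σ (suc x) = rename suc (σ x)

subst* : (ℕ → Λ) → Λ → Λ
subst* σ (var x) = σ x
subst* σ (M · N) = subst* σ M · subst* σ N
subst* σ (ƛ M)   = ƛ (subst* (lift σ) M)

-- M [ N ] substitutes N for the variable bound by the ƛ of ƛ M.
_[_] : Λ → Λ → Λ
M [ N ] = subst* σ M
  where
  σ : ℕ → Λ
  σ zero    = N
  σ (suc x) = var x

data Redex : Λ → Set where
  root  : ∀ {M N} → Redex (ƛ M · N)
  left  : ∀ {M N} → Redex M → Redex (M · N)
  right : ∀ {M N} → Redex N → Redex (M · N)
  under : ∀ {M}   → Redex M → Redex (ƛ M)

fire : ∀ {M} → Redex M → Λ
fire (root {M} {N})  = M [ N ]
fire (left {N = N} r)  = fire r · N
fire (right {M = M} r) = M · fire r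
fire (under r)         = ƛ (fire r)

infix 4 _→β_

_→β_ : Λ → Λ → Set
M →β N = Σ[ r ∈ Redex M ] fire r ≡ N

NormalForm : Λ → Set
NormalForm M = ∀ N → ¬ (M →β N)

-- Terms are written fully parenthesised, as x, (MN) and (λx.M), a variable
-- being a single symbol.  Omitting redundant parentheses does not change
-- the order of the redexes.
symbols : Λ → ℕ
symbols (var x) = 1
symbols (M · N) = 2 ℕ.+ (symbols M ℕ.+ symbols N)
symbols (ƛ M)   = 5 ℕ.+ symbols M

-- The number of symbols written before the first symbol of the redex.
position : ∀ {M} → Redex M → ℕ
position root              = 0
position (left r)          = 1 ℕ.+ position r
position (right {M = M} r) = 1 ℕ.+ symbols M ℕ.+ position r
position (under r)         = 4 ℕ.+ position r

redexes : (M : Λ) → List (Redex M)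
redexes (var x)       = []
redexes (ƛ M)         = map under (redexes M)
redexes (ƛ M · N)     = root ∷ map left (redexes (ƛ M)) ++ map right (redexes N)
redexes (var x · N)   = map right (redexes N)
redexes (L · M · N)   = map left (redexes (L · M)) ++ map right (redexes N)

redexes-complete : ∀ {M} (r : Redex M) → r ∈ redexes M
redexes-complete root = here refl
redexes-complete (under r) = ∈-map⁺ under (redexes-complete r)
redexes-complete (left {ƛ _} r) =
  there (∈-++⁺ˡ (∈-map⁺ left (redexes-complete r)))
redexes-complete (left {_ · _} r) = ∈-++⁺ˡ (∈-map⁺ left (redexes-complete r))
redexes-complete (right {ƛ M} r) =
  there (∈-++⁺ʳ (map left (redexes (ƛ M))) (∈-map⁺ right (redexes-complete r)))
redexes-complete (right {var _} r) = ∈-map⁺ right (redexes-complete r)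
redexes-complete (right {L · M} r) =
  ∈-++⁺ʳ (map left (redexes (L · M))) (∈-map⁺ right (redexes-complete r))

open Extrema ℕ.≤-totalOrder using (argmin; argmax)

data Strategy : Set where
  LO RI : Strategy

select : Strategy → ∀ {M} → Redex M → List (Redex M) → Redex M
select LO r rs = argmin position r rs
select RI r rs = argmax position r rs

-- A strategy is undefined (nothing) exactly on normal forms.
step : Strategy → Λ → Maybe Λ
step S M with redexes M
... | []     = nothing
... | r ∷ rs = just (fire (select S r rs))

iterate : Strategy → Λ → ℕ → Maybe Λ
iterate S M zero    = just M
iterate S M (suc k) = iterate S M k >>= step S

data Steps (S : Strategy) (M : Λ) : ℝ∞ → Set where
  terminates : ∀ k {N} → iterate S M k ≡ just N → NormalForm N →
               Steps S M (fin (fromℕ k))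
  diverges   : (∀ k → ∃ λ N → iterate S M k ≡ just N) → Steps S M +∞

δ : Λ → Λ → ℝ
δ M N = if does (M ≟ N) then 1ℝ else 0ℝ

P : ℝ → Λ → Maybe (Λ → ℝ)
P ε M = zipWith (λ L R N → ε * δ L N + (1ℝ - ε) * δ R N) (step LO M) (step RI M)

ℙ : ℝ → Λ → Λ → ℝ
ℙ ε M N = maybe (λ d → d N) 0ℝ (P ε M)

-- A duplicate-free list of terms outside which ρ_i vanishes (see
-- ρ-vanishes), so that sums of ρ_i over all of Λ are sums over this list.
support : Λ → ℕ → List Λ
support M zero    = M ∷ []
support M (suc i) =
  deduplicate _≟_ (concatMap (λ L → fromMaybe (step LO L) ++ fromMaybe (step RI L)) (support M i))

ρ : ℝ → Λ → ℕ → Λ → ℝ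
ρ ε M zero    N = δ M N
ρ ε M (suc i) N = Σᴸ (support M i) λ L → ρ ε M i L * ℙ ε L N

mass : ℝ → Λ → ℕ → ℝ
mass ε M i = Σᴸ (support M i) (ρ ε M i)

ExpLen : Λ → ℝ → ℝ∞ → Set
ExpLen M ε s = mass ε M SumsTo s

private
  successors : Λ → List Λ
  successors L = fromMaybe (step LO L) ++ fromMaybe (step RI L)

  δ-vanishes : ∀ M N → M ≢ N → ∀ n → seq (δ M N) n ≡ 0ℚ
  δ-vanishes M N M≢N n rewrite dec-false (M ≟ N) M≢N = refl

  ℙ-vanishes : ∀ ε L N → N ∉ successors L → ∀ n → seq (ℙ ε L N) n ≡ 0ℚ
  ℙ-vanishes ε L N N∉ n with step LO L | step RI L
  ... | nothing | _       = refl
  ... | just _  | nothing = refl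
  ... | just A  | just B
    rewrite δ-vanishes A N (λ A≡N → N∉ (here (sym A≡N))) n
          | δ-vanishes B N (λ B≡N → N∉ (there (here (sym B≡N)))) n
          | ℚ.*-zeroʳ (seq ε n) | ℚ.*-zeroʳ (1ℚ ℚ.- seq ε n) = refl

  Σᴸ-vanishes : ∀ {A : Set} (xs : List A) (f : A → ℝ) n →
    (∀ x → x ∈ xs → seq (f x) n ≡ 0ℚ) → seq (Σᴸ xs f) n ≡ 0ℚ
  Σᴸ-vanishes []       f n h = refl
  Σᴸ-vanishes (x ∷ xs) f n h
    rewrite h x (here refl) | Σᴸ-vanishes xs f n (λ y y∈ → h y (there y∈)) = refl

ρ-vanishes : ∀ ε M i N → N ∉ support M i → ∀ n → seq (ρ ε M i N) n ≡ 0ℚ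
ρ-vanishes ε M zero    N N∉ n = δ-vanishes M N (λ M≡N → N∉ (here (sym M≡N))) n
ρ-vanishes ε M (suc i) N N∉ n =
  Σᴸ-vanishes (support M i) (λ L → ρ ε M i L * ℙ ε L N) n λ L L∈ →
    trans (cong (seq (ρ ε M i L) n ℚ.*_)
                (ℙ-vanishes ε L N (λ N∈ → N∉ (∈-deduplicate⁺ _≟_ (∈-concatMap⁺ successors (lose L∈ N∈)))) n))
          (ℚ.*-zeroʳ (seq (ρ ε M i L) n))

{-# OPTIONS --safe #-}

-- Take M = (λx. (λz. y) (x x)) I with I = λw. w.  LO reduces M to
-- (λz. y) (I I) and then to y; RI reduces M to (λx. y) I and then to y.  Only
-- the mixed sequence that starts with LO and continues with RI contracts I I
-- and needs a third step; it has probability ε (1 - ε), so that the expected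
-- length is 2 + ε (1 - ε).

module Submission where

open import Defs
open import Data.List using ([]; deduplicate; concatMap; fromMaybe; _++_)
open import Data.Maybe using (just)
open import Data.Nat as ℕ using (suc)
import Data.Nat.Properties as ℕ
open import Data.Product using (_×_; _,_; ∃)
open import Data.Rational as ℚ using (0ℚ; 1ℚ)
import Data.Rational.Properties as ℚ
import Data.Rational.Solver as ℚSolver
open import Relation.Binary.PropositionalEquality
  using (_≡_; refl; sym; trans; cong; subst; subst₂)

support-stable : ∀ M {i j} → support M i ≡ [] → i ℕ.≤ j → support M j ≡ []
support-stable M {i} eq i≤j = go (ℕ.≤⇒≤′ i≤j)
  where
  go : ∀ {j} → i ℕ.≤′ j → support M j ≡ []
  go (ℕ.≤′-reflexive refl) = eq
  go (ℕ.≤′-step i≤′j) = cong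
    (λ Ls → deduplicate _≟_ (concatMap (λ L → fromMaybe (step LO L) ++ fromMaybe (step RI L)) Ls))
    (go i≤′j)

-- Every term after index `i` is a sum over an empty support, so it adds exactly `0ℚ`. The index is
-- `suc i` because that is the first term not yet in the partial sum.
partialSum-stable : ∀ ε M {i n} → support M (suc i) ≡ [] → i ℕ.≤ n → ∀ m →
  seq (partialSum (mass ε M) n) m ≡ seq (partialSum (mass ε M) i) m
partialSum-stable ε M {i} eq i≤n m = go (ℕ.≤⇒≤′ i≤n)
  where
  go : ∀ {n} → i ℕ.≤′ n →
    seq (partialSum (mass ε M) n) m ≡ seq (partialSum (mass ε M) i) m
  go (ℕ.≤′-reflexive refl) = refl
  go (ℕ.≤′-step {n} i≤′n) = trans
    (cong (λ Ls → seq (partialSum (mass ε M) n) m ℚ.+ seq (Σᴸ Ls (ρ ε M (suc n))) m)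
          (support-stable M eq (ℕ.s≤s (ℕ.≤′⇒≤ i≤′n))))
    (trans (ℚ.+-identityʳ _) (go i≤′n))

stable⇒SumsTo : ∀ {f i} →
  (∀ n → i ℕ.≤ n → ∀ m → seq (partialSum f n) m ≡ seq (partialSum f i) m) →
  f SumsTo fin (partialSum f i)
stable⇒SumsTo {f} {i} stable δ (d , 0<d , N , d≤δ) = i , λ n i≤n →
    -- Both differences are exactly zero, so the gap `d` witnessing `0ℝ < δ` serves for both bounds.
    (d , 0<d , N , λ m N≤m → subst₂ ℚ._≤_ (ℚ.+-comm d _) (sym (diff n i≤n m))
      (subst (d ℚ.- seq δ m ℚ.≤_) (ℚ.+-inverseʳ (seq δ m))
        (ℚ.+-monoˡ-≤ (ℚ.- seq δ m) (bound m N≤m))))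
  , (d , 0<d , N , λ m N≤m → subst (λ q → q ℚ.+ d ℚ.≤ seq δ m) (sym (diff n i≤n m)) (d≤δ m N≤m))
  where
  diff : ∀ n → i ℕ.≤ n → ∀ m → seq (partialSum f n - partialSum f i) m ≡ 0ℚ
  diff n i≤n m = trans (cong (ℚ._- seq (partialSum f i) m) (stable n i≤n m))
                       (ℚ.+-inverseʳ (seq (partialSum f i) m))
  bound : ∀ m → N ℕ.≤ m → d ℚ.≤ seq δ m
  bound m N≤m = subst (ℚ._≤ seq δ m) (ℚ.+-identityˡ d) (d≤δ m N≤m)

I : Λ
I = ƛ (var 0)

-- The free variable y is `var 0` at top level, hence `var 2` under the two binders.
M₀ : Λ
M₀ = ƛ (ƛ (var 2) · (var 0 · var 0)) · I

var-normal : ∀ {x} → NormalForm (var x)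
var-normal _ (() , _)

expected-length : ∀ ε m →
  seq (partialSum (mass ε M₀) 3) m ≡ (1ℚ ℚ.+ 1ℚ) ℚ.+ seq ε m ℚ.* (1ℚ ℚ.- seq ε m)
expected-length ε m = identity (seq ε m)
  where
  open ℚSolver.+-*-Solver
  -- aᵢ and bᵢ are the values of ρᵢ on the first and second term of its support,
  -- kept unsimplified so that the left-hand side is the unfolded partial sum.
  identity : ∀ e → _
  identity = solve 1 (λ e →
    let 𝟘 = con 0ℚ
        𝟙 = con 1ℚ
        -- Transition probabilities into a term that is the LO reduct only, the RI reduct only,
        -- both, or neither. In `a₃` the factor `𝟘` after `a₂` reflects that y is normal.
        lo = e :* 𝟙 :+ (𝟙 :- e) :* 𝟘
        ri = e :* 𝟘 :+ (𝟙 :- e) :* 𝟙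
        one = e :* 𝟙 :+ (𝟙 :- e) :* 𝟙
        zer = e :* 𝟘 :+ (𝟙 :- e) :* 𝟘
        a₁ = 𝟙 :* lo :+ 𝟘
        b₁ = 𝟙 :* ri :+ 𝟘
        a₂ = a₁ :* lo :+ (b₁ :* one :+ 𝟘)
        b₂ = a₁ :* ri :+ (b₁ :* zer :+ 𝟘)
        a₃ = a₂ :* 𝟘 :+ (b₂ :* one :+ 𝟘)
    in ((𝟘 :+ (a₁ :+ (b₁ :+ 𝟘))) :+ (a₂ :+ (b₂ :+ 𝟘))) :+ (a₃ :+ 𝟘)
       := (𝟙 :+ 𝟙) :+ e :* (𝟙 :- e)) refl

2<expected-length : ∀ ε → 0ℝ < ε → ε < 1ℝ → fromℕ 2 < partialSum (mass ε M₀) 3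
2<expected-length ε (d , 0<d , N , d≤ε) (d′ , 0<d′ , N′ , ε≤1) =
  -- Eventually ε is at least `d` and 1 - ε at least `d′`, so the excess ε (1 - ε) is at least their
  -- product.
  d ℚ.* d′ , 0<dd′ , N ℕ.⊔ N′ , λ m N≤m →
  let e = seq ε m
      d≤e = subst (ℚ._≤ e) (ℚ.+-identityˡ d) (d≤ε m (ℕ.m⊔n≤o⇒m≤o N N′ N≤m))
      d′≤1-e = subst (ℚ._≤ 1ℚ ℚ.- e) (cancel e d′)
                 (ℚ.+-monoˡ-≤ (ℚ.- e) (ε≤1 m (ℕ.m⊔n≤o⇒n≤o N N′ N≤m)))
  in subst ((1ℚ ℚ.+ 1ℚ) ℚ.+ d ℚ.* d′ ℚ.≤_) (sym (expected-length ε m))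
       (ℚ.+-monoʳ-≤ (1ℚ ℚ.+ 1ℚ) (ℚ.≤-trans
         (ℚ.*-monoˡ-≤-nonNeg d {{ℚ.pos⇒nonNeg d}} d′≤1-e)
         (ℚ.*-monoʳ-≤-nonNeg (1ℚ ℚ.- e)
           {{ℚ.nonNegative (ℚ.≤-trans (ℚ.<⇒≤ 0<d′) d′≤1-e)}} d≤e)))
  where
  instance
    d-pos : ℚ.Positive d
    d-pos = ℚ.positive 0<d
  0<dd′ : 0ℚ ℚ.< d ℚ.* d′
  0<dd′ = subst (ℚ._< d ℚ.* d′) (ℚ.*-zeroʳ d) (ℚ.*-monoʳ-<-pos d 0<d′)
  cancel : ∀ p q → (p ℚ.+ q) ℚ.- p ≡ q
  cancel = solve 2 (λ p q → (p :+ q) :- p := q) refl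
    where open ℚSolver.+-*-Solver

mainTheorem4 : ∃ λ (M : Λ) → ∀ (ε : ℝ) → 0ℝ < ε → ε < 1ℝ →
    (Steps LO M ≺ ExpLen M ε) × (Steps RI M ≺ ExpLen M ε)
mainTheorem4 = M₀ , λ ε 0<ε ε<1 → two≺ LO refl ε 0<ε ε<1 , two≺ RI refl ε 0<ε ε<1
  where
  two≺ : ∀ S → iterate S M₀ 2 ≡ just (var 0) →
    ∀ ε → 0ℝ < ε → ε < 1ℝ → Steps S M₀ ≺ ExpLen M₀ ε
  two≺ S eq ε 0<ε ε<1 =
      fin (fromℕ 2) , fin (partialSum (mass ε M₀) 3)
    , terminates 2 eq var-normal
    -- No computation lasts more than three steps: `support M₀ 4` evaluates to `[]`, whatever ε is.
    , stable⇒SumsTo {mass ε M₀} {3} (λ n 3≤n → partialSum-stable ε M₀ refl 3≤n)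
    , fin<fin (2<expected-length ε 0<ε ε<1)
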